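{- Let $k,n\in\mathbb N^+$ and $\mathbf C=(c_0,\dots,c_k)\in\{0,1\}^{k+1}$. For every integer $m$ with $1\le m\le n$, $$O_{\mathbf C}(n,m+c_k-1)=(n-1)!^k\sum_{\substack{J\subseteq\{2,\dots,n\}\\ |J|=m-1}}\ \prod_{j\in J}F_j(\mathbf C)\prod_{j\in\{2,\dots,n\}\setminus J}F_j(\mathbf C'),$$ and for every integer $m\ge 0$ with $m=0$ or $m>n$, $O_{\mathbf C}(n,m+c_k-1)=0$.
   Context: Fix integers $k\ge 1$, $n\ge 1$ and a vector $\mathbf C=(c_0,c_1,\dots,c_k)\in\{0,1\}^{k+1}$; put $\mathbf C'=(1,\dots,1)-\mathbf C=(c'_0,\dots,c'_k)$. Consider $k$-tuples $(\pi_1,\dots,\pi_k)$ of permutations of $\{1,\dots,n\}$ (there are $n!^k$ of them). A position $\alpha\in\{1,\dots,n\}$ is a record of a permutation $\pi$ if $\pi(\alpha)<\pi(\alpha')$ for every $\alpha'<\alpha$ (so position $1$ is always a record); equivalently, the records index the unique minimum-cardinality subset of the points $\{(\alpha,\pi(\alpha))\}$ such that every point either lies in it or is strictly dominated in both coordinates by one of its points (the "optimization set" for the relation $(<,<)$). For a tuple, let $l_\alpha$ be the number of $\beta\in\{1,\dots,k\}$ for which $\alpha$ is a record of $\pi_\beta$ (so $l_1=k$). The $\mathbf C$ sequential optimization set of the tuple is $S=\{\alpha: c_{l_\alpha}=1\}$, and its weight is $|S|$. For an integer $m$, the $\mathbf C$ sequential optimization number $O_{\mathbf C}(n,m)$ is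 the number of $k$-tuples whose weight equals $m$ (so $O_{\mathbf C}(n,m)=0$ if $m<0$ or $m>n$). For $j\ge 2$ and $X=(x_0,\dots,x_k)\in\mathbb R^{k+1}$ set $F_j(X)=\sum_{\beta=0}^k\binom{k}{\beta}\frac{x_\beta}{(j-1)^\beta}$. Empty products equal $1$. -}

module Defs where

open import Data.Bool.Base using (Bool; true; false; if_then_else_)
open import Data.Fin.Base as Fin using (Fin; toℕ; fromℕ<)
import Data.Fin.Properties as Fin
open import Data.Fin.Subset using (Subset; ∣_∣)
open import Data.Fin.Subset.Properties using (_∈?_)
open import Data.Integer.Base as ℤ using (ℤ; +_)
import Data.Integer.Properties as ℤ
open import Data.List.Base as List using (List; []; _∷_; [_]; allFin; cartesianProductWith; filter; foldr; length)
open import Data.Nat.Base using (ℕ; zero; suc; pred; _^_; s≤s; NonZero; NonTrivial; 2+)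
open import Data.Nat.Combinatorics using (_C_)
import Data.Nat.Properties as ℕ
open import Data.Rational.Base as ℚ using (ℚ; 0ℚ; 1ℚ; _/_)
import Data.Rational.Properties as ℚ
open import Data.Vec.Base as Vec using (Vec; []; _∷_; lookup; tabulate; count)
open import Data.Vec.Properties using (count≤n)
open import Function.Consequences.Propositional
  using (strictlySurjective⇒surjective; surjective⇒strictlySurjective)
open import Function.Definitions using (Bijective)
open import Relation.Binary.PropositionalEquality using (_≡_)
open import Relation.Nullary.Decidable using (Dec; map′; _×-dec_; _→-dec_)

open import Algebra.Properties.CommutativeMonoid.Sum ℚ.+-0-commutativeMonoid
  using (sum⁺-syntax)

private
  variable
    k n : ℕ
    A   : Set

-- Each word of length n over xs is listed exactly once when xs has no
-- repetitions.
words : List A → (n : ℕ) → List (Vec A n)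
words xs zero    = [ [] ]
words xs (suc n) = cartesianProductWith _∷_ xs (words xs n)

-- Permutations of {1,…,n} are handled in one-line notation; positions and
-- values are shifted down by one, so that they live in Fin n.
IsPermutation : Vec (Fin n) n → Set
IsPermutation π = Bijective _≡_ _≡_ (lookup π)

isPermutation? : (π : Vec (Fin n) n) → Dec (IsPermutation π)
isPermutation? π =
  map′ (λ inj {x} {y} → inj x y) (λ inj x y → inj {x} {y})
    (Fin.all? λ x → Fin.all? λ y →
      (lookup π x Fin.≟ lookup π y) →-dec (x Fin.≟ y))
  ×-dec
  map′ strictlySurjective⇒surjective surjective⇒strictlySurjective
    (Fin.all? λ y → Fin.any? λ x → lookup π x Fin.≟ y)

permutations : (n : ℕ) → List (Vec (Fin n) n)
permutations n = filter isPermutation? (words (allFin n) n)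

IsRecord : Fin n → Vec (Fin n) n → Set
IsRecord α π = ∀ α′ → α′ Fin.< α → lookup π α Fin.< lookup π α′

isRecord? : (α : Fin n) (π : Vec (Fin n) n) → Dec (IsRecord α π)
isRecord? α π = Fin.all? λ α′ →
  (α′ Fin.<? α) →-dec (lookup π α Fin.<? lookup π α′)

-- The number l_α ≤ k, as an index into (c₀, …, c_k).
recordCount : Vec (Vec (Fin n) n) k → Fin n → Fin (suc k)
recordCount πs α = fromℕ< (s≤s (count≤n (isRecord? α) πs))

-- A vector in {0,1}^(k+1) is a Vec Bool (suc k), with true standing for 1.
optimizationSet : Vec Bool (suc k) → Vec (Vec (Fin n) n) k → Subset n
optimizationSet c πs = tabulate λ α → lookup c (recordCount πs α)

weight : Vec Bool (suc k) → Vec (Vec (Fin n) n) k → ℕ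
weight c πs = ∣ optimizationSet c πs ∣

O : Vec Bool (suc k) → ℕ → ℤ → ℕ
O {k} c n m =
  length (filter (λ πs → + weight c πs ℤ.≟ m) (words (permutations n) k))

bit : Bool → ℕ
bit b = if b then 1 else 0

toℚ : ℕ → ℚ
toℚ a = + a / 1

⟦_⟧ : Vec Bool n → Vec ℚ n
⟦ c ⟧ = Vec.map (λ b → toℚ (bit b)) c

⟦_⟧′ : Vec Bool n → Vec ℚ n
⟦ c ⟧′ = Vec.map (λ x → 1ℚ ℚ.- x) ⟦ c ⟧

-- F_j(X) is only ever evaluated at 0/1 vectors, so rational X suffices.
F : (j : ℕ) .{{_ : NonTrivial j}} → Vec ℚ (suc k) → ℚ
F {k} j@(2+ _) X =
  ∑[ β ≤ k ] (_/_ (+ (k C toℕ β)) (pred j ^ toℕ β) {{ℕ.m^n≢0 (pred j) (toℕ β)}}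
              ℚ.* lookup X β)

subsetsOfSize : (s n : ℕ) → List (Subset n)
subsetsOfSize s n = filter (λ J → ∣ J ∣ ℕ.≟ s) (words (false ∷ true ∷ []) n)

∑-list : List A → (A → ℚ) → ℚ
∑-list xs f = foldr ℚ._+_ 0ℚ (List.map f xs)

infixl 10 ∑-list
syntax ∑-list xs (λ x → e) = ∑[ x ∈ˡ xs ] e

-- Subsets of {2,…,n} are encoded as Subset (pred n), the index i standing
-- for j = 2 + i.
∏-from2 : Subset n → ((j : ℕ) .{{_ : NonTrivial j}} → ℚ) → ℚ
∏-from2 {n} J f =
  foldr ℚ._*_ 1ℚ (List.map (λ i → f (2+ (toℕ i))) (filter (_∈? J) (allFin n)))

infixl 10 ∏-from2
syntax ∏-from2 J (λ j → e) = ∏[ j ∈ J ] e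

{-# OPTIONS --safe #-}

-- Deleting the last entry v of a permutation of n + 1 values and closing the
-- gap is a bijection onto pairs (v, permutation of n values).  It keeps the
-- record status of the other positions, and the last position is a record iff
-- v is the least value.  For k-tuples, the last position is thus in the
-- optimization set according to how many of the k last values are least, which
-- for n ≥ 1 yields the factor n^k F_{n+1}(C) (in the set) or n^k F_{n+1}(C′)
-- (not in it), independently of the remaining positions.  Position 1 contributes
-- c_k, and the product of these factors expands into the sum over subsets J.
module Submission where

open import Defs
open import Algebra.Bundles using (CommutativeRing)
open import Data.Bool.Base using (Bool; true; false; if_then_else_)
open import Data.Fin.Base as Fin using (Fin; zero; suc; toℕ; fromℕ; inject₁; punchIn; punchOut)
import Data.Fin.Properties as Fin
open import Data.Fin.Relation.Unary.Top using (view; ‵fromℕ; ‵inject₁)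
open import Data.Fin.Subset using (Subset; ∁; ∣_∣)
open import Data.Fin.Subset.Properties using (_∈?_; ∣p∣≤n)
open import Data.Integer.Base as ℤ using (ℤ; +_)
import Data.Integer.Properties as ℤ
open import Data.Integer.Solver using () renaming (module +-*-Solver to ℤ-Solver)
open import Data.List.Base as List
  using (List; []; _∷_; _++_; allFin; cartesianProductWith; filter; length)
import Data.List.Properties as List
open import Data.List.Membership.Propositional using (_∈_)
open import Data.List.Membership.Propositional.Properties
  using (∈-filter⁺; ∈-filter⁻; ∈-cartesianProductWith⁺; ∈-cartesianProductWith⁻; ∈-allFin)
open import Data.List.Membership.Propositional.Properties.WithK using (unique∧set⇒bag)
open import Data.List.Relation.Binary.BagAndSetEquality using (∼bag⇒↭)
open import Data.List.Relation.Binary.Permutation.Propositional using (_↭_; refl; prep; swap; trans)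
import Data.List.Relation.Unary.All as ListAll
open import Data.List.Relation.Unary.Any using (here; there)
open import Data.List.Relation.Unary.Unique.Propositional using (Unique; []; _∷_)
import Data.List.Relation.Unary.Unique.Propositional.Properties as Unique
open import Data.Nat.Base as ℕ
  using (ℕ; zero; suc; pred; _+_; _*_; _^_; _!; _∸_; _≤_; _<_; _>_; z≤n; s≤s; NonZero; 2+)
open import Data.Nat.Combinatorics using (_C_; nCk+nC[k+1]≡[n+1]C[k+1]; k>n⇒nCk≡0)
import Data.Nat.Properties as ℕ
open import Data.Product.Base using (_×_; _,_; proj₂; ∃)
open import Data.Rational.Base as ℚ using (ℚ; 0ℚ; 1ℚ; _/_; fromℚᵘ)
import Data.Rational.Properties as ℚ
open import Data.Rational.Solver using (module +-*-Solver)
import Data.Rational.Unnormalised.Base as ℚᵘ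
import Data.Rational.Unnormalised.Properties as ℚᵘ
open import Data.Sum.Base using (_⊎_; inj₂)
open import Data.Vec.Base as Vec using (Vec; []; _∷_; _∷ʳ_; lookup; tabulate; zipWith; count; last)
import Data.Vec.Properties as Vec
open import Data.Vec.Relation.Unary.All as All using (All; []; _∷_)
open import Function.Base using (_∘_; id)
open import Function.Bundles using (mk⇔; _⇔_)
open import Function.Consequences.Propositional
  using (strictlySurjective⇒surjective; surjective⇒strictlySurjective)
open import Function.Definitions using (Injective; StrictlySurjective)
open import Level using (0ℓ)
open import Relation.Binary.PropositionalEquality as ≡
  using (_≡_; _≢_; refl; sym; cong; cong₂; subst; _≗_; module ≡-Reasoning)
open import Relation.Nullary.Decidable using (yes; no; does; does-⇔; dec-true; dec-false)
open import Relation.Nullary.Negation using (¬_; contradiction)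
open import Relation.Unary using (Pred; Decidable)

open import Algebra.Properties.CommutativeMonoid.Sum ℚ.+-0-commutativeMonoid
  using (sum; sum⁺-syntax; sum-cong-≗; sum-init-last; ∑-distrib-+)
open import Algebra.Properties.Semiring.Sum (CommutativeRing.semiring ℚ.+-*-commutativeRing)
  using (*-distribˡ-sum)

open +-*-Solver using (solve; _:+_; _:*_; _:=_; con)
open ≡-Reasoning

private
  variable
    k n : ℕ
    A B D : Set

-- Naturals and unit fractions inside `ℚ`

fromℚᵘ-homo-+ : ∀ p q → fromℚᵘ (p ℚᵘ.+ q) ≡ fromℚᵘ p ℚ.+ fromℚᵘ q
fromℚᵘ-homo-+ p q = ℚ.toℚᵘ-injective (ℚᵘ.≃-trans (ℚ.toℚᵘ-fromℚᵘ _) (ℚᵘ.≃-sym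
  (ℚᵘ.≃-trans (ℚ.toℚᵘ-homo-+ (fromℚᵘ p) (fromℚᵘ q))
    (ℚᵘ.+-cong (ℚ.toℚᵘ-fromℚᵘ p) (ℚ.toℚᵘ-fromℚᵘ q)))))

fromℚᵘ-homo-* : ∀ p q → fromℚᵘ (p ℚᵘ.* q) ≡ fromℚᵘ p ℚ.* fromℚᵘ q
fromℚᵘ-homo-* p q = ℚ.toℚᵘ-injective (ℚᵘ.≃-trans (ℚ.toℚᵘ-fromℚᵘ _) (ℚᵘ.≃-sym
  (ℚᵘ.≃-trans (ℚ.toℚᵘ-homo-* (fromℚᵘ p) (fromℚᵘ q))
    (ℚᵘ.*-cong (ℚ.toℚᵘ-fromℚᵘ p) (ℚ.toℚᵘ-fromℚᵘ q)))))

natᵘ : ℕ → ℚᵘ.ℚᵘ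
natᵘ a = ℚᵘ.mkℚᵘ (+ a) 0

toℚ-+ : ∀ a b → toℚ (a + b) ≡ toℚ a ℚ.+ toℚ b
toℚ-+ a b = ≡.trans
  -- Addition over denominator 1 leaves the numerator `a * 1 + b * 1`.
  (cong (_/ 1) (cong₂ ℤ._+_ (sym (ℤ.*-identityʳ (+ a))) (sym (ℤ.*-identityʳ (+ b)))))
  (fromℚᵘ-homo-+ (natᵘ a) (natᵘ b))

toℚ-* : ∀ a b → toℚ (a * b) ≡ toℚ a ℚ.* toℚ b
toℚ-* a b = ≡.trans (cong (_/ 1) (ℤ.pos-* a b)) (fromℚᵘ-homo-* (natᵘ a) (natᵘ b))

toℚ-injective : ∀ {a b} → toℚ a ≡ toℚ b → a ≡ b
toℚ-injective {a} {b} eq with ℚ.fromℚᵘ-injective {natᵘ a} {natᵘ b} eq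
... | ℚᵘ.*≡* e = ℤ.+-injective (≡.trans (sym (ℤ.*-identityʳ (+ a))) (≡.trans e (ℤ.*-identityʳ (+ b))))

/-as-* : ∀ a d .{{_ : NonZero d}} → + a / d ≡ toℚ a ℚ.* (+ 1 / d)
/-as-* a d@(suc d-1) = ≡.trans
  (ℚ.fromℚᵘ-cong {ℚᵘ.mkℚᵘ (+ a) d-1} {natᵘ a ℚᵘ.* ℚᵘ.mkℚᵘ (+ 1) d-1}
    (ℚᵘ.*≡* (cong₂ ℤ._*_ (sym (ℤ.*-identityʳ (+ a))) (cong (λ e → + suc e) (ℕ.+-identityʳ d-1)))))
  (fromℚᵘ-homo-* (natᵘ a) (ℚᵘ.mkℚᵘ (+ 1) d-1))

toℚ-inverse : ∀ d .{{_ : NonZero d}} → toℚ d ℚ.* (+ 1 / d) ≡ 1ℚ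
toℚ-inverse d@(suc d-1) = ≡.trans (sym (/-as-* d d))
  (ℚ.fromℚᵘ-cong {ℚᵘ.mkℚᵘ (+ d) d-1} {natᵘ 1} (ℚᵘ.*≡* (ℤ.*-comm (+ d) (+ 1))))

1/-* : ∀ a b .{{_ : NonZero a}} .{{_ : NonZero b}} .{{_ : NonZero (a * b)}} →
  + 1 / (a * b) ≡ (+ 1 / a) ℚ.* (+ 1 / b)
1/-* a@(suc a-1) b@(suc b-1) = fromℚᵘ-homo-* (ℚᵘ.mkℚᵘ (+ 1) a-1) (ℚᵘ.mkℚᵘ (+ 1) b-1)

-- Finite sums over lists

∑-++ : ∀ (xs ys : List A) f → ∑-list (xs ++ ys) f ≡ ∑-list xs f ℚ.+ ∑-list ys f
∑-++ []       ys f = sym (ℚ.+-identityˡ _)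
∑-++ (x ∷ xs) ys f = ≡.trans (cong (f x ℚ.+_) (∑-++ xs ys f)) (sym (ℚ.+-assoc (f x) _ _))

∑-map : ∀ (g : A → B) xs f → ∑-list (List.map g xs) f ≡ ∑-list xs (f ∘ g)
∑-map g xs f = cong (List.foldr ℚ._+_ 0ℚ) (sym (List.map-∘ xs))

∑-cong-∈ : ∀ (xs : List A) {f g} → (∀ {x} → x ∈ xs → f x ≡ g x) → ∑-list xs f ≡ ∑-list xs g
∑-cong-∈ []       eq = refl
∑-cong-∈ (x ∷ xs) eq = cong₂ ℚ._+_ (eq (here refl)) (∑-cong-∈ xs (eq ∘ there))

∑-cong : ∀ (xs : List A) {f g} → f ≗ g → ∑-list xs f ≡ ∑-list xs g
∑-cong xs eq = ∑-cong-∈ xs (λ {x} _ → eq x)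

∑-0 : ∀ (xs : List A) → ∑[ x ∈ˡ xs ] 0ℚ ≡ 0ℚ
∑-0 []       = refl
∑-0 (x ∷ xs) = ≡.trans (ℚ.+-identityˡ _) (∑-0 xs)

∑-+ : ∀ (xs : List A) f g → (∑[ x ∈ˡ xs ] (f x ℚ.+ g x)) ≡ ∑-list xs f ℚ.+ ∑-list xs g
∑-+ []       f g = refl
∑-+ (x ∷ xs) f g = ≡.trans (cong ((f x ℚ.+ g x) ℚ.+_) (∑-+ xs f g))
  (solve 4 (λ a b c d → (a :+ b) :+ (c :+ d) := (a :+ c) :+ (b :+ d)) refl (f x) (g x) _ _)

∑-*ʳ : ∀ (xs : List A) f q → (∑[ x ∈ˡ xs ] (f x ℚ.* q)) ≡ ∑-list xs f ℚ.* q
∑-*ʳ []       f q = sym (ℚ.*-zeroˡ q)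
∑-*ʳ (x ∷ xs) f q = ≡.trans (cong (f x ℚ.* q ℚ.+_) (∑-*ʳ xs f q)) (sym (ℚ.*-distribʳ-+ q (f x) _))

∑-*ˡ : ∀ q (xs : List A) f → (∑[ x ∈ˡ xs ] (q ℚ.* f x)) ≡ q ℚ.* ∑-list xs f
∑-*ˡ q xs f = ≡.trans (∑-cong xs (λ x → ℚ.*-comm q (f x))) (≡.trans (∑-*ʳ xs f q) (ℚ.*-comm _ q))

∑-swap : ∀ (xs : List A) (ys : List B) (f : A → B → ℚ) →
         (∑[ x ∈ˡ xs ] ∑[ y ∈ˡ ys ] f x y) ≡ (∑[ y ∈ˡ ys ] ∑[ x ∈ˡ xs ] f x y)
∑-swap []       ys f = sym (∑-0 ys)
∑-swap (x ∷ xs) ys f = ≡.trans (cong (∑-list ys (f x) ℚ.+_) (∑-swap xs ys f)) (sym (∑-+ ys (f x) _))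

∑-↭ : ∀ {xs ys : List A} f → xs ↭ ys → ∑-list xs f ≡ ∑-list ys f
∑-↭ f refl         = refl
∑-↭ f (prep x p)   = cong (f x ℚ.+_) (∑-↭ f p)
∑-↭ f (swap x y p) = ≡.trans (cong (λ s → f x ℚ.+ (f y ℚ.+ s)) (∑-↭ f p))
  (solve 3 (λ a b s → a :+ (b :+ s) := b :+ (a :+ s)) refl (f x) (f y) _)
∑-↭ f (trans p q)  = ≡.trans (∑-↭ f p) (∑-↭ f q)

∑-cartesianProductWith : ∀ (g : A → B → D) xs ys f →
  ∑-list (cartesianProductWith g xs ys) f ≡ (∑[ x ∈ˡ xs ] ∑[ y ∈ˡ ys ] f (g x y))
∑-cartesianProductWith g []       ys f = refl
∑-cartesianProductWith g (x ∷ xs) ys f = ≡.trans (∑-++ (List.map (g x) ys) _ f)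
  (cong₂ ℚ._+_ (∑-map (g x) ys f) (∑-cartesianProductWith g xs ys f))

∑-filter : ∀ {P : Pred A 0ℓ} (P? : Decidable P) xs f →
  ∑-list (filter P? xs) f ≡ (∑[ x ∈ˡ xs ] (if does (P? x) then f x else 0ℚ))
∑-filter P? []       f = refl
∑-filter P? (x ∷ xs) f with does (P? x)
... | true  = cong (f x ℚ.+_) (∑-filter P? xs f)
... | false = ≡.trans (∑-filter P? xs f) (sym (ℚ.+-identityˡ _))

toℚ-length : ∀ (xs : List A) → toℚ (length xs) ≡ (∑[ x ∈ˡ xs ] 1ℚ)
toℚ-length []       = refl
toℚ-length (x ∷ xs) = ≡.trans (toℚ-+ 1 (length xs)) (cong (1ℚ ℚ.+_) (toℚ-length xs))

∑-allFin-suc : ∀ n (f : Fin (suc n) → ℚ) →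
  ∑-list (allFin (suc n)) f ≡ f zero ℚ.+ (∑[ i ∈ˡ allFin n ] f (suc i))
∑-allFin-suc n f = cong (f zero ℚ.+_)
  (≡.trans (cong (λ xs → ∑-list xs f) (sym (List.map-tabulate id suc))) (∑-map suc (allFin n) f))

∑-const : ∀ (xs : List A) q → (∑[ x ∈ˡ xs ] q) ≡ toℚ (length xs) ℚ.* q
∑-const xs q = ≡.trans (∑-cong xs (λ _ → sym (ℚ.*-identityˡ q)))
  (≡.trans (∑-*ʳ xs (λ _ → 1ℚ) q) (cong (ℚ._* q) (sym (toℚ-length xs))))

-- Words: sums, membership, uniqueness

∑-words-suc : ∀ (xs : List A) k f →
  ∑-list (words xs (suc k)) f ≡ (∑[ x ∈ˡ xs ] ∑[ w ∈ˡ words xs k ] f (x ∷ w))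
∑-words-suc xs k f = ∑-cartesianProductWith _∷_ xs (words xs k) f

-- The extended permutations come in another order than `permutations (suc n)`, so sums over tuples
-- have to be invariant under reordering the alphabet.
∑-words-↭ : ∀ {xs ys : List A} k f → xs ↭ ys → ∑-list (words xs k) f ≡ ∑-list (words ys k) f
∑-words-↭ zero    f p = refl
∑-words-↭ {xs = xs} {ys} (suc k) f p = begin
  ∑-list (words xs (suc k)) f                       ≡⟨ ∑-words-suc xs k f ⟩
  (∑[ x ∈ˡ xs ] ∑[ w ∈ˡ words xs k ] f (x ∷ w))     ≡⟨ ∑-cong xs (λ x → ∑-words-↭ k (f ∘ (x ∷_)) p) ⟩
  (∑[ x ∈ˡ xs ] ∑[ w ∈ˡ words ys k ] f (x ∷ w))     ≡⟨ ∑-↭ _ p ⟩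
  (∑[ x ∈ˡ ys ] ∑[ w ∈ˡ words ys k ] f (x ∷ w))     ≡⟨ ∑-words-suc ys k f ⟨
  ∑-list (words ys (suc k)) f                       ∎

-- A word of pairs is a pair of words. This separates the `k` last values of a tuple from its `k`
-- shortened permutations.
∑-words-cartesianProductWith : ∀ (g : A → B → D) xs ys k f →
  ∑-list (words (cartesianProductWith g xs ys) k) f
    ≡ (∑[ v ∈ˡ words xs k ] ∑[ w ∈ˡ words ys k ] f (zipWith g v w))
∑-words-cartesianProductWith g xs ys zero    f = sym (ℚ.+-identityʳ _)
∑-words-cartesianProductWith g xs ys (suc k) f = begin
  ∑-list (words zs (suc k)) f
    ≡⟨ ∑-words-suc zs k f ⟩
  (∑[ z ∈ˡ zs ] ∑[ u ∈ˡ words zs k ] f (z ∷ u))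
    ≡⟨ ∑-cartesianProductWith g xs ys _ ⟩
  (∑[ x ∈ˡ xs ] ∑[ y ∈ˡ ys ] ∑[ u ∈ˡ words zs k ] f (g x y ∷ u))
    ≡⟨ ∑-cong xs (λ x → ∑-cong ys λ y → ∑-words-cartesianProductWith g xs ys k _) ⟩
  (∑[ x ∈ˡ xs ] ∑[ y ∈ˡ ys ] ∑[ v ∈ˡ words xs k ] ∑[ w ∈ˡ words ys k ] f (g x y ∷ zipWith g v w))
    ≡⟨ ∑-cong xs (λ x → ∑-swap ys (words xs k) _) ⟩
  (∑[ x ∈ˡ xs ] ∑[ v ∈ˡ words xs k ] ∑[ y ∈ˡ ys ] ∑[ w ∈ˡ words ys k ] f (g x y ∷ zipWith g v w))
    ≡⟨ ∑-cong xs (λ x → ∑-cong (words xs k) λ v → ∑-words-suc ys k (λ w → f (zipWith g (x ∷ v) w))) ⟨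
  (∑[ x ∈ˡ xs ] ∑[ v ∈ˡ words xs k ] ∑[ w ∈ˡ words ys (suc k) ] f (zipWith g (x ∷ v) w))
    ≡⟨ ∑-words-suc xs k (λ v → ∑[ w ∈ˡ words ys (suc k) ] f (zipWith g v w)) ⟨
  (∑[ v ∈ˡ words xs (suc k) ] ∑[ w ∈ˡ words ys (suc k) ] f (zipWith g v w)) ∎
  where zs = cartesianProductWith g xs ys

∈-words⁺ : ∀ {xs : List A} {w : Vec A n} → All (_∈ xs) w → w ∈ words xs n
∈-words⁺ []       = here refl
∈-words⁺ (p ∷ ps) = ∈-cartesianProductWith⁺ _∷_ p (∈-words⁺ ps)

∈-words⁻ : ∀ {xs : List A} {w : Vec A n} → w ∈ words xs n → All (_∈ xs) w
∈-words⁻ {n = zero}  {w = []} _ = []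
∈-words⁻ {n = suc n} {xs = xs} w∈ with ∈-cartesianProductWith⁻ _∷_ xs (words xs n) w∈
... | _ , _ , x∈ , v∈ , refl = x∈ ∷ ∈-words⁻ v∈

words-unique : ∀ {xs : List A} → Unique xs → ∀ n → Unique (words xs n)
words-unique xs! zero    = ListAll.[] ∷ []
words-unique xs! (suc n) = Unique.cartesianProductWith⁺ _∷_ Vec.∷-injective xs! (words-unique xs! n)

-- Permutations and their extension by a last value

-- Pigeonhole: if `y` were missed, punching `y` out of every value would inject `Fin (suc n)` into
-- `Fin n`.
injective⇒strictlySurjective : {f : Fin n → Fin n} → Injective _≡_ _≡_ f → StrictlySurjective _≡_ f
injective⇒strictlySurjective {n = suc n} {f} inj y with Fin.any? (λ x → f x Fin.≟ y)
... | yes hit = hit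
... | no miss = contradiction
  (Fin.injective⇒≤ {f = λ x → punchOut (y≢f x)} (inj ∘ Fin.punchOut-injective (y≢f _) (y≢f _)))
  ℕ.1+n≰n
  where
  y≢f : ∀ x → y ≢ f x
  y≢f x y≡fx = miss (x , sym y≡fx)

injective⇒isPermutation : (π : Vec (Fin n) n) → Injective _≡_ _≡_ (lookup π) → IsPermutation π
injective⇒isPermutation π inj = inj , strictlySurjective⇒surjective (injective⇒strictlySurjective inj)

∈-permutations⁺ : {π : Vec (Fin n) n} → IsPermutation π → π ∈ permutations n
∈-permutations⁺ perm = ∈-filter⁺ isPermutation? (∈-words⁺ (All.universal ∈-allFin _)) perm

∈-permutations⁻ : {π : Vec (Fin n) n} → π ∈ permutations n → IsPermutation π
∈-permutations⁻ {n = n} π∈ = proj₂ (∈-filter⁻ isPermutation? {xs = words (allFin n) n} π∈)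

lookup-∷ʳ-inject₁ : ∀ (xs : Vec A n) x i → lookup (xs ∷ʳ x) (inject₁ i) ≡ lookup xs i
lookup-∷ʳ-inject₁ (y ∷ xs) x zero    = refl
lookup-∷ʳ-inject₁ (y ∷ xs) x (suc i) = lookup-∷ʳ-inject₁ xs x i

lookup-∷ʳ-fromℕ : ∀ (xs : Vec A n) x → lookup (xs ∷ʳ x) (fromℕ n) ≡ x
lookup-∷ʳ-fromℕ []       x = refl
lookup-∷ʳ-fromℕ (y ∷ xs) x = lookup-∷ʳ-fromℕ xs x

tabulate-∷ʳ : ∀ (f : Fin (suc n) → A) → tabulate f ≡ tabulate (f ∘ inject₁) ∷ʳ f (fromℕ n)
tabulate-∷ʳ {n = zero}  f = refl
tabulate-∷ʳ {n = suc n} f = cong (f zero ∷_) (tabulate-∷ʳ (f ∘ suc))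

-- `punchIn v` opens a gap at `v`, so this undoes deleting the last entry `v` and closing the gap in
-- the values.
append : Fin (suc n) → Vec (Fin n) n → Vec (Fin (suc n)) (suc n)
append v π = Vec.map (punchIn v) π ∷ʳ v

append-inject₁ : ∀ (v : Fin (suc n)) π i → lookup (append v π) (inject₁ i) ≡ punchIn v (lookup π i)
append-inject₁ v π i = ≡.trans
  (lookup-∷ʳ-inject₁ (Vec.map (punchIn v) π) v i)
  (Vec.lookup-map i (punchIn v) π)

append-fromℕ : ∀ (v : Fin (suc n)) π → lookup (append v π) (fromℕ n) ≡ v
append-fromℕ v π = lookup-∷ʳ-fromℕ (Vec.map (punchIn v) π) v

map-injective : {f : A → B} → Injective _≡_ _≡_ f →
  ∀ (xs ys : Vec A n) → Vec.map f xs ≡ Vec.map f ys → xs ≡ ys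
map-injective inj []       []       eq = refl
map-injective inj (x ∷ xs) (y ∷ ys) eq =
  cong₂ _∷_ (inj (Vec.∷-injectiveˡ eq)) (map-injective inj xs ys (Vec.∷-injectiveʳ eq))

append-injective : ∀ {v w : Fin (suc n)} {π ρ} → append v π ≡ append w ρ → v ≡ w × π ≡ ρ
append-injective {v = v} {π = π} {ρ} eq with Vec.∷ʳ-injective (Vec.map (punchIn v) π) _ eq
... | eqs , refl = refl , map-injective (Fin.punchIn-injective v _ _) π ρ eqs

append-isPermutation : ∀ (v : Fin (suc n)) π → IsPermutation π → IsPermutation (append v π)
append-isPermutation v π (inj , _) = injective⇒isPermutation (append v π) inj′
  where
  inj′ : Injective _≡_ _≡_ (lookup (append v π))
  inj′ {x} {y} eq with view x | view y
  ... | ‵fromℕ     | ‵fromℕ     = refl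
  ... | ‵fromℕ     | ‵inject₁ j = contradiction
    (≡.trans (sym (append-inject₁ v π j)) (≡.trans (sym eq) (append-fromℕ v π))) (Fin.punchInᵢ≢i v _)
  ... | ‵inject₁ i | ‵fromℕ     = contradiction
    (≡.trans (sym (append-inject₁ v π i)) (≡.trans eq (append-fromℕ v π))) (Fin.punchInᵢ≢i v _)
  ... | ‵inject₁ i | ‵inject₁ j = cong inject₁ (inj (Fin.punchIn-injective v _ _
    (≡.trans (sym (append-inject₁ v π i)) (≡.trans eq (append-inject₁ v π j)))))

-- The last entry serves as `v`. Injectivity of `π` keeps it apart from all earlier entries, which
-- is what lets `punchOut` close the gap.
append-surjective : ∀ (π : Vec (Fin (suc n)) (suc n)) → IsPermutation π →
                    ∃ λ v → ∃ λ ρ → IsPermutation ρ × π ≡ append v ρ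
append-surjective {n} π (inj , _) = v , ρ , injective⇒isPermutation ρ inj′ , π≡
  where
  v = lookup π (fromℕ n)
  v≢ : ∀ i → v ≢ lookup π (inject₁ i)
  v≢ i eq = Fin.fromℕ≢inject₁ (inj eq)
  ρ = tabulate λ i → punchOut (v≢ i)
  inj′ : Injective _≡_ _≡_ (lookup ρ)
  inj′ {i} {j} eq = Fin.inject₁-injective (inj (Fin.punchOut-injective (v≢ i) (v≢ j)
    (≡.trans (sym (Vec.lookup∘tabulate _ i)) (≡.trans eq (Vec.lookup∘tabulate _ j)))))
  π≡ : π ≡ append v ρ
  π≡ = begin
    π
      ≡⟨ Vec.tabulate∘lookup π ⟨
    tabulate (lookup π)
      ≡⟨ tabulate-∷ʳ (lookup π) ⟩
    tabulate (lookup π ∘ inject₁) ∷ʳ v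
      ≡⟨ cong (_∷ʳ v) (Vec.tabulate-cong (λ i → sym (Fin.punchIn-punchOut (v≢ i)))) ⟩
    tabulate (λ i → punchIn v (punchOut (v≢ i))) ∷ʳ v
      ≡⟨ cong (_∷ʳ v) (Vec.tabulate-∘ (punchIn v) _) ⟩
    append v ρ ∎

permutations-unique : ∀ n → Unique (permutations n)
permutations-unique n = Unique.filter⁺ isPermutation? (words-unique (Unique.allFin⁺ n) n)

-- Both lists are free of repetitions and have the same members, so they agree as bags. Their orders
-- differ: the left one is sorted by first entry, the right one by last entry.
permutations-suc-↭ : ∀ n →
  permutations (suc n) ↭ cartesianProductWith append (allFin (suc n)) (permutations n)
permutations-suc-↭ n = ∼bag⇒↭ (unique∧set⇒bag (permutations-unique (suc n))
  (Unique.cartesianProductWith⁺ append append-injective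
    (Unique.allFin⁺ (suc n)) (permutations-unique n))
  (mk⇔ to from))
  where
  appended = cartesianProductWith append (allFin (suc n)) (permutations n)
  to : ∀ {π} → π ∈ permutations (suc n) → π ∈ appended
  to {π} π∈ with append-surjective π (∈-permutations⁻ π∈)
  ... | v , ρ , ρ-perm , refl = ∈-cartesianProductWith⁺ append (∈-allFin v) (∈-permutations⁺ ρ-perm)
  from : ∀ {π} → π ∈ appended → π ∈ permutations (suc n)
  from π∈ with ∈-cartesianProductWith⁻ append (allFin (suc n)) (permutations n) π∈
  ... | v , ρ , _ , ρ∈ , refl = ∈-permutations⁺ (append-isPermutation v ρ (∈-permutations⁻ ρ∈))

-- Records and weight of an extended tuple

punchIn-mono-< : ∀ (v : Fin (suc n)) {i j} → i Fin.< j → punchIn v i Fin.< punchIn v j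
punchIn-mono-< v {i} {j} i<j = ℕ.≰⇒> (ℕ.<⇒≱ i<j ∘ Fin.punchIn-cancel-≤ v j i)

punchIn-cancel-< : ∀ (v : Fin (suc n)) {i j} → punchIn v i Fin.< punchIn v j → i Fin.< j
punchIn-cancel-< v {i} {j} lt = ℕ.≰⇒> (ℕ.<⇒≱ lt ∘ Fin.punchIn-mono-≤ v j i)

inject₁-mono-< : {i j : Fin n} → i Fin.< j → inject₁ i Fin.< inject₁ j
inject₁-mono-< {i = i} {j} = ≡.subst₂ _<_ (sym (Fin.toℕ-inject₁ i)) (sym (Fin.toℕ-inject₁ j))

inject₁-cancel-< : {i j : Fin n} → inject₁ i Fin.< inject₁ j → i Fin.< j
inject₁-cancel-< {i = i} {j} = ≡.subst₂ _<_ (Fin.toℕ-inject₁ i) (Fin.toℕ-inject₁ j)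

inject₁<fromℕ : (i : Fin n) → inject₁ i Fin.< fromℕ n
inject₁<fromℕ {n} i = ≡.subst₂ _<_ (sym (Fin.toℕ-inject₁ i)) (sym (Fin.toℕ-fromℕ n)) (Fin.toℕ<n i)

-- Being a record only compares a value with the values at earlier positions, and `punchIn v` and
-- `inject₁` preserve and reflect strict order.
isRecord-append-inject₁ : ∀ (v : Fin (suc n)) π α → IsRecord (inject₁ α) (append v π) ⇔ IsRecord α π
isRecord-append-inject₁ {n} v π α = mk⇔ to from
  where
  to : IsRecord (inject₁ α) (append v π) → IsRecord α π
  to rec i i<α = punchIn-cancel-< v (≡.subst₂ Fin._<_ (append-inject₁ v π α) (append-inject₁ v π i)
    (rec (inject₁ i) (inject₁-mono-< i<α)))
  from : IsRecord α π → IsRecord (inject₁ α) (append v π)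
  from rec i i<α with view i
  -- The new position comes after `inject₁ α`, so it is not among the earlier ones.
  ... | ‵fromℕ     = contradiction (inject₁<fromℕ α) (ℕ.<⇒≯ i<α)
  ... | ‵inject₁ j = ≡.subst₂ Fin._<_ (sym (append-inject₁ v π α)) (sym (append-inject₁ v π j))
    (punchIn-mono-< v (rec j (inject₁-cancel-< i<α)))

zero-isRecord-append-fromℕ : ∀ (π : Vec (Fin n) n) → IsRecord (fromℕ n) (append zero π)
zero-isRecord-append-fromℕ {n} π i i<n with view i
... | ‵fromℕ     = contradiction i<n (ℕ.<-irrefl refl)
... | ‵inject₁ j = ≡.subst₂ Fin._<_
  (sym (append-fromℕ zero π)) (sym (append-inject₁ zero π j)) (s≤s z≤n)

-- By surjectivity `π` takes the value `zero` somewhere, and `punchIn (suc v)` fixes `zero`. An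
-- earlier position thus holds the least value, and a record would need `suc v` below `zero`.
suc-¬isRecord-append-fromℕ : ∀ (v : Fin n) π → IsPermutation π →
  ¬ IsRecord (fromℕ n) (append (suc v) π)
suc-¬isRecord-append-fromℕ {suc n} v π (_ , surj) rec with surjective⇒strictlySurjective surj zero
... | i , eq = contradiction
  (≡.subst₂ Fin._<_ (append-fromℕ (suc v) π)
    (≡.trans (append-inject₁ (suc v) π i) (cong (punchIn (suc v)) eq))
    (rec (inject₁ i) (inject₁<fromℕ i)))
  λ ()

-- Taking the outcome of the test as an equation on `does` lets each use supply it by `dec-true`,
-- `dec-false` or `does-⇔`.
count-∷ : ∀ {P : Pred A 0ℓ} (P? : Decidable P) {x b} (xs : Vec A n) →
  does (P? x) ≡ b → count P? (x ∷ xs) ≡ bit b + count P? xs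
count-∷ P? {x} xs refl with does (P? x)
... | true  = refl
... | false = refl

-- This will be the record count of the last position. The type `Fin (suc k)` makes it an index into
-- `c`, whence the `inject₁` when the count stays the same.
zeros : Vec (Fin (suc n)) k → Fin (suc k)
zeros []           = zero
zeros (zero  ∷ vs) = suc (zeros vs)
zeros (suc _ ∷ vs) = inject₁ (zeros vs)

count-isRecord-inject₁ : ∀ (vs : Vec (Fin (suc n)) k) πs α →
  count (isRecord? (inject₁ α)) (zipWith append vs πs) ≡ count (isRecord? α) πs
count-isRecord-inject₁ []       []       α = refl
count-isRecord-inject₁ (v ∷ vs) (π ∷ πs) α = begin
  count (isRecord? (inject₁ α)) (append v π ∷ zipWith append vs πs)
    ≡⟨ count-∷ (isRecord? (inject₁ α)) {append v π} (zipWith append vs πs)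
         (does-⇔ (isRecord-append-inject₁ v π α) (isRecord? (inject₁ α) (append v π)) (isRecord? α π)) ⟩
  bit (does (isRecord? α π)) + count (isRecord? (inject₁ α)) (zipWith append vs πs)
    ≡⟨ cong (_+_ (bit (does (isRecord? α π)))) (count-isRecord-inject₁ vs πs α) ⟩
  bit (does (isRecord? α π)) + count (isRecord? α) πs
    ≡⟨ count-∷ (isRecord? α) {π} πs refl ⟨
  count (isRecord? α) (π ∷ πs) ∎

count-isRecord-fromℕ : ∀ (vs : Vec (Fin (suc n)) k) {πs} → All IsPermutation πs →
  count (isRecord? (fromℕ n)) (zipWith append vs πs) ≡ toℕ (zeros vs)
count-isRecord-fromℕ     []           []                = refl
count-isRecord-fromℕ {n} (zero  ∷ vs) {π ∷ πs} (_ ∷ ps) = ≡.trans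
  (count-∷ (isRecord? (fromℕ n)) {append zero π} (zipWith append vs πs)
    (dec-true (isRecord? (fromℕ n) (append zero π)) (zero-isRecord-append-fromℕ π)))
  (cong suc (count-isRecord-fromℕ vs ps))
count-isRecord-fromℕ {n} (suc v ∷ vs) {π ∷ πs} (p ∷ ps) = begin
  count (isRecord? (fromℕ n)) (append (suc v) π ∷ zipWith append vs πs)
    ≡⟨ count-∷ (isRecord? (fromℕ n)) {append (suc v) π} (zipWith append vs πs)
         (dec-false (isRecord? (fromℕ n) (append (suc v) π)) (suc-¬isRecord-append-fromℕ v π p)) ⟩
  count (isRecord? (fromℕ n)) (zipWith append vs πs)
    ≡⟨ count-isRecord-fromℕ vs ps ⟩
  toℕ (zeros vs)
    ≡⟨ Fin.toℕ-inject₁ (zeros vs) ⟨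
  toℕ (inject₁ (zeros vs)) ∎

recordCount-inject₁ : ∀ (vs : Vec (Fin (suc n)) k) πs α →
  recordCount (zipWith append vs πs) (inject₁ α) ≡ recordCount πs α
recordCount-inject₁ vs πs α = Fin.fromℕ<-cong _ _ (count-isRecord-inject₁ vs πs α) _ _

recordCount-fromℕ : ∀ (vs : Vec (Fin (suc n)) k) {πs} → All IsPermutation πs →
  recordCount (zipWith append vs πs) (fromℕ n) ≡ zeros vs
recordCount-fromℕ vs ps = Fin.toℕ-injective (≡.trans (Fin.toℕ-fromℕ< _) (count-isRecord-fromℕ vs ps))

∣∷ʳ∣ : ∀ (p : Subset n) b → ∣ p ∷ʳ b ∣ ≡ bit b + ∣ p ∣
∣∷ʳ∣ []          true  = refl
∣∷ʳ∣ []          false = refl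
∣∷ʳ∣ (false ∷ p) b     = ∣∷ʳ∣ p b
∣∷ʳ∣ (true  ∷ p) b     = ≡.trans (cong suc (∣∷ʳ∣ p b)) (sym (ℕ.+-suc (bit b) _))

-- Old positions keep their record counts, and the new one has count `zeros vs`, which does not
-- involve `πs`. Hence the optimization set gains one final bit, decided by the last values alone.
weight-append : ∀ c (vs : Vec (Fin (suc n)) k) {πs} → All IsPermutation πs →
  weight c (zipWith append vs πs) ≡ bit (lookup c (zeros vs)) + weight c πs
weight-append {n} c vs {πs} ps = begin
  weight c (zipWith append vs πs)
    ≡⟨ cong ∣_∣ (tabulate-∷ʳ (λ α → lookup c (recordCount (zipWith append vs πs) α))) ⟩
  ∣ tabulate (λ α → lookup c (recordCount (zipWith append vs πs) (inject₁ α)))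
      ∷ʳ lookup c (recordCount (zipWith append vs πs) (fromℕ n)) ∣
    ≡⟨ cong₂ (λ p i → ∣ p ∷ʳ lookup c i ∣)
        (Vec.tabulate-cong (λ α → cong (lookup c) (recordCount-inject₁ vs πs α)))
        (recordCount-fromℕ vs ps) ⟩
  ∣ optimizationSet c πs ∷ʳ lookup c (zeros vs) ∣
    ≡⟨ ∣∷ʳ∣ (optimizationSet c πs) _ ⟩
  bit (lookup c (zeros vs)) + weight c πs ∎

-- Counting as a sum of indicators

ind : Bool → ℚ
ind b = toℚ (bit b)

-- A sum of indicators in `ℚ` can be rearranged as a sum and compared with the rational `F`.
Oℚ : Vec Bool (suc k) → ℕ → ℤ → ℚ
Oℚ {k} c n w = ∑[ πs ∈ˡ words (permutations n) k ] ind (does (+ weight c πs ℤ.≟ w))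

if-ind : ∀ b q → (if b then q else 0ℚ) ≡ ind b ℚ.* q
if-ind true  q = sym (ℚ.*-identityˡ q)
if-ind false q = sym (ℚ.*-zeroˡ q)

toℚ-O : ∀ (c : Vec Bool (suc k)) n w → toℚ (O c n w) ≡ Oℚ c n w
toℚ-O {k} c n w = begin
  toℚ (O c n w)
    ≡⟨ toℚ-length (filter P? tuples) ⟩
  (∑[ πs ∈ˡ filter P? tuples ] 1ℚ)
    ≡⟨ ∑-filter P? tuples (λ _ → 1ℚ) ⟩
  (∑[ πs ∈ˡ tuples ] (if does (P? πs) then 1ℚ else 0ℚ))
    ≡⟨ ∑-cong tuples (λ πs → ≡.trans (if-ind (does (P? πs)) 1ℚ) (ℚ.*-identityʳ _)) ⟩
  Oℚ c n w ∎
  where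
  tuples = words (permutations n) k
  P? = λ πs → + weight c πs ℤ.≟ w

-- Moving `b` across the equation gives a target weight for the shorter tuple. In `ℤ` this target
-- may be negative without harm.
does-+-≟ : ∀ a b w → does (+ (b + a) ℤ.≟ w) ≡ does (+ a ℤ.≟ w ℤ.- + b)
does-+-≟ a b w = does-⇔ (mk⇔ to from) (+ (b + a) ℤ.≟ w) (+ a ℤ.≟ w ℤ.- + b)
  where
  to : + (b + a) ≡ w → + a ≡ w ℤ.- + b
  to refl = ℤ-Solver.solve 2 (λ a b → a ℤ-Solver.:= (b ℤ-Solver.:+ a) ℤ-Solver.:- b) refl (+ a) (+ b)
  from : + a ≡ w ℤ.- + b → + (b + a) ≡ w
  from eq = ≡.trans (cong (ℤ._+_ (+ b)) eq)
    (ℤ-Solver.solve 2 (λ b w → b ℤ-Solver.:+ (w ℤ-Solver.:- b) ℤ-Solver.:= w) refl (+ b) w)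

Oℚ-suc : ∀ (c : Vec Bool (suc k)) n w → Oℚ c (suc n) w ≡
  (∑[ vs ∈ˡ words (allFin (suc n)) k ] Oℚ c n (w ℤ.- + bit (lookup c (zeros vs))))
Oℚ-suc {k} c n w = begin
  Oℚ c (suc n) w
    ≡⟨ ∑-words-↭ k δ (permutations-suc-↭ n) ⟩
  ∑-list (words (cartesianProductWith append (allFin (suc n)) (permutations n)) k) δ
    ≡⟨ ∑-words-cartesianProductWith append (allFin (suc n)) (permutations n) k δ ⟩
  (∑[ vs ∈ˡ words (allFin (suc n)) k ] ∑[ πs ∈ˡ words (permutations n) k ] δ (zipWith append vs πs))
    -- `weight-append` asks for permutations, so the inner sums are compared only on members of the
    -- list of tuples.
    ≡⟨ ∑-cong (words (allFin (suc n)) k) (λ vs → ∑-cong-∈ (words (permutations n) k) λ {πs} πs∈ →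
         cong ind (≡.trans
           (cong (λ m → does (+ m ℤ.≟ w)) (weight-append c vs (All.map ∈-permutations⁻ (∈-words⁻ πs∈))))
           (does-+-≟ (weight c πs) (bit (lookup c (zeros vs))) w))) ⟩
  (∑[ vs ∈ˡ words (allFin (suc n)) k ] Oℚ c n (w ℤ.- + bit (lookup c (zeros vs)))) ∎
  where
  δ : Vec (Vec (Fin (suc n)) (suc n)) k → ℚ
  δ πs = ind (does (+ weight c πs ℤ.≟ w))

-- Distribution of the number of least last values

-- Behind this sum stands the binomial distribution: `(k C β) * n ^ (k ∸ β)` of the tuples have
-- exactly `β` entries `zero`.
∑zeros : ℕ → ∀ k → (Fin (suc k) → ℚ) → ℚ
∑zeros n k h = ∑[ vs ∈ˡ words (allFin (suc n)) k ] h (zeros vs)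

-- The first entry is either `zero`, which raises the count, or one of `n` others, which leave it
-- unchanged.
∑zeros-suc : ∀ n k h →
  ∑zeros n (suc k) h ≡ ∑zeros n k (h ∘ suc) ℚ.+ toℚ n ℚ.* ∑zeros n k (h ∘ inject₁)
∑zeros-suc n k h = begin
  ∑zeros n (suc k) h
    ≡⟨ ∑-words-suc (allFin (suc n)) k (h ∘ zeros) ⟩
  (∑[ v ∈ˡ allFin (suc n) ] ∑[ vs ∈ˡ words (allFin (suc n)) k ] h (zeros (v ∷ vs)))
    ≡⟨ ∑-allFin-suc n (λ v → ∑[ vs ∈ˡ words (allFin (suc n)) k ] h (zeros (v ∷ vs))) ⟩
  ∑zeros n k (h ∘ suc) ℚ.+ (∑[ v ∈ˡ allFin n ] ∑zeros n k (h ∘ inject₁))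
    ≡⟨ cong (∑zeros n k (h ∘ suc) ℚ.+_) (∑-const (allFin n) (∑zeros n k (h ∘ inject₁))) ⟩
  ∑zeros n k (h ∘ suc) ℚ.+ toℚ (length (allFin n)) ℚ.* ∑zeros n k (h ∘ inject₁)
    ≡⟨ cong (λ m → ∑zeros n k (h ∘ suc) ℚ.+ toℚ m ℚ.* ∑zeros n k (h ∘ inject₁))
         (List.length-tabulate {n = n} id) ⟩
  ∑zeros n k (h ∘ suc) ℚ.+ toℚ n ℚ.* ∑zeros n k (h ∘ inject₁) ∎

-- Over `Fin 1` every entry is `zero`. This is the case of position 1, a record of all `k`
-- permutations.
∑zeros-0 : ∀ k h → ∑zeros 0 k h ≡ h (fromℕ k)
∑zeros-0 zero    h = ℚ.+-identityʳ (h zero)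
∑zeros-0 (suc k) h = begin
  ∑zeros 0 (suc k) h
    ≡⟨ ∑zeros-suc 0 k h ⟩
  ∑zeros 0 k (h ∘ suc) ℚ.+ 0ℚ ℚ.* ∑zeros 0 k (h ∘ inject₁)
    ≡⟨ cong₂ ℚ._+_ (∑zeros-0 k (h ∘ suc)) (ℚ.*-zeroˡ (∑zeros 0 k (h ∘ inject₁))) ⟩
  h (fromℕ (suc k)) ℚ.+ 0ℚ
    ≡⟨ ℚ.+-identityʳ _ ⟩
  h (fromℕ (suc k)) ∎

1/_^_ : ∀ d .{{_ : NonZero d}} → ℕ → ℚ
1/ d ^ β = _/_ (+ 1) (d ^ β) {{ℕ.m^n≢0 d β}}

1/-^-suc : ∀ d .{{_ : NonZero d}} β → 1/ d ^ suc β ≡ (+ 1 / d) ℚ.* 1/ d ^ β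
1/-^-suc d {{d≢0}} β = 1/-* d (d ^ β) {{d≢0}} {{ℕ.m^n≢0 d β}} {{ℕ.m^n≢0 d (suc β)}}

-- This is `F` at `j = d + 1` with a function in place of the vector, so that induction on `k` can
-- pass to `h ∘ suc` and `h ∘ inject₁`.
binomialSum : ∀ d .{{_ : NonZero d}} k → (Fin (suc k) → ℚ) → ℚ
binomialSum d k h = ∑[ β ≤ k ] (toℚ (k C toℕ β) ℚ.* 1/ d ^ toℕ β ℚ.* h β)

F≡binomialSum : ∀ n (X : Vec ℚ (suc k)) → F (2+ n) X ≡ binomialSum (suc n) k (lookup X)
F≡binomialSum {k} n X = sum-cong-≗ {suc k} λ β → cong (ℚ._* lookup X β)
  (/-as-* (k C toℕ β) (suc n ^ toℕ β) {{ℕ.m^n≢0 (suc n) (toℕ β)}})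

-- Pascal's rule splits each coefficient: one part gives the sum for `h ∘ suc` with a factor `1 / d`
-- taken out, the other part the sum for `h ∘ inject₁`.
binomialSum-suc : ∀ d .{{_ : NonZero d}} k h → binomialSum d (suc k) h
  ≡ (+ 1 / d) ℚ.* binomialSum d k (h ∘ suc) ℚ.+ binomialSum d k (h ∘ inject₁)
binomialSum-suc d k h = begin
  t (suc k) zero ℚ.+ (∑[ β ≤ k ] t (suc k) (suc β))
    ≡⟨ cong (t (suc k) zero ℚ.+_) (sum-cong-≗ pascal) ⟩
  -- `suc k C 0` and `k C 0` agree by computation, so the term at `zero` already belongs to `t k`.
  t k zero ℚ.+ (∑[ β ≤ k ] (u β ℚ.+ t k (suc β)))
    ≡⟨ cong (t k zero ℚ.+_) (∑-distrib-+ u (t k ∘ suc)) ⟩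
  t k zero ℚ.+ (sum u ℚ.+ sum (t k ∘ suc))
    ≡⟨ solve 3 (λ a b c → a :+ (b :+ c) := b :+ (a :+ c)) refl (t k zero) (sum u) (sum (t k ∘ suc)) ⟩
  sum u ℚ.+ sum (t k)
    ≡⟨ cong₂ ℚ._+_
         (sym (*-distribˡ-sum q (λ β → toℚ (k C toℕ β) ℚ.* 1/ d ^ toℕ β ℚ.* h (suc β))))
         -- `t k` is summed up to `suc k`, one index too far for `binomialSum d k`. The surplus term
         -- carries `k C suc k` and vanishes.
         (sum-init-last (t k)) ⟩
  q ℚ.* binomialSum d k (h ∘ suc) ℚ.+ (sum (t k ∘ inject₁) ℚ.+ t k (fromℕ (suc k)))
    ≡⟨ cong (q ℚ.* binomialSum d k (h ∘ suc) ℚ.+_) (cong₂ ℚ._+_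
         (sum-cong-≗ λ β → cong (λ i → toℚ (k C i) ℚ.* 1/ d ^ i ℚ.* h (inject₁ β))
           (Fin.toℕ-inject₁ β)) last≡0) ⟩
  q ℚ.* binomialSum d k (h ∘ suc) ℚ.+ (binomialSum d k (h ∘ inject₁) ℚ.+ 0ℚ)
    ≡⟨ cong (q ℚ.* binomialSum d k (h ∘ suc) ℚ.+_) (ℚ.+-identityʳ _) ⟩
  q ℚ.* binomialSum d k (h ∘ suc) ℚ.+ binomialSum d k (h ∘ inject₁) ∎
  where
  q = + 1 / d
  t : ℕ → Fin (suc (suc k)) → ℚ
  t j β = toℚ (j C toℕ β) ℚ.* 1/ d ^ toℕ β ℚ.* h β
  u : Fin (suc k) → ℚ
  u β = q ℚ.* (toℚ (k C toℕ β) ℚ.* 1/ d ^ toℕ β ℚ.* h (suc β))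
  pascal : ∀ β → t (suc k) (suc β) ≡ u β ℚ.+ t k (suc β)
  pascal β = begin
    toℚ (suc k C suc (toℕ β)) ℚ.* r′ ℚ.* y
      ≡⟨ cong (λ m → toℚ m ℚ.* r′ ℚ.* y) (nCk+nC[k+1]≡[n+1]C[k+1] k (toℕ β)) ⟨
    toℚ (k C toℕ β + k C suc (toℕ β)) ℚ.* r′ ℚ.* y
      ≡⟨ cong (λ m → m ℚ.* r′ ℚ.* y) (toℚ-+ (k C toℕ β) (k C suc (toℕ β))) ⟩
    (a ℚ.+ b) ℚ.* r′ ℚ.* y
      ≡⟨ solve 4 (λ a b r y → (a :+ b) :* r :* y := a :* r :* y :+ b :* r :* y) refl a b r′ y ⟩
    a ℚ.* r′ ℚ.* y ℚ.+ t k (suc β)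
      ≡⟨ cong (λ e → a ℚ.* e ℚ.* y ℚ.+ t k (suc β)) (1/-^-suc d (toℕ β)) ⟩
    a ℚ.* (q ℚ.* r) ℚ.* y ℚ.+ t k (suc β)
      ≡⟨ cong (ℚ._+ t k (suc β))
           (solve 4 (λ a q r y → a :* (q :* r) :* y := q :* (a :* r :* y)) refl a q r y) ⟩
    u β ℚ.+ t k (suc β) ∎
    where
    a  = toℚ (k C toℕ β)
    b  = toℚ (k C suc (toℕ β))
    r  = 1/ d ^ toℕ β
    r′ = 1/ d ^ suc (toℕ β)
    y  = h (suc β)
  last≡0 : t k (fromℕ (suc k)) ≡ 0ℚ
  last≡0 = begin
    toℚ (k C toℕ (fromℕ (suc k))) ℚ.* r ℚ.* y
      ≡⟨ cong (λ m → toℚ m ℚ.* r ℚ.* y)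
           (k>n⇒nCk≡0 (subst (k <_) (sym (Fin.toℕ-fromℕ (suc k))) ℕ.≤-refl)) ⟩
    0ℚ ℚ.* r ℚ.* y
      ≡⟨ cong (ℚ._* y) (ℚ.*-zeroˡ r) ⟩
    0ℚ ℚ.* y
      ≡⟨ ℚ.*-zeroˡ y ⟩
    0ℚ ∎
    where
    r = 1/ d ^ toℕ (fromℕ (suc k))
    y = h (fromℕ (suc k))

-- Both sides obey the same recursion in `k`. Taking out the full power of `suc n` is what creates
-- the negative powers in `F`.
∑zeros≡binomialSum : ∀ n k h → ∑zeros (suc n) k h ≡ toℚ (suc n ^ k) ℚ.* binomialSum (suc n) k h
∑zeros≡binomialSum n zero    h =
  solve 1 (λ x → x :+ con 0ℚ := con 1ℚ :* (con 1ℚ :* con 1ℚ :* x :+ con 0ℚ)) refl (h zero)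
∑zeros≡binomialSum n (suc k) h = begin
  ∑zeros d (suc k) h
    ≡⟨ ∑zeros-suc d k h ⟩
  ∑zeros d k (h ∘ suc) ℚ.+ toℚ d ℚ.* ∑zeros d k (h ∘ inject₁)
    ≡⟨ cong₂ (λ x y → x ℚ.+ toℚ d ℚ.* y)
         (∑zeros≡binomialSum n k (h ∘ suc)) (∑zeros≡binomialSum n k (h ∘ inject₁)) ⟩
  p ℚ.* B₁ ℚ.+ toℚ d ℚ.* (p ℚ.* B₂)
    ≡⟨ cong (ℚ._+ toℚ d ℚ.* (p ℚ.* B₂)) (ℚ.*-identityˡ (p ℚ.* B₁)) ⟨
  1ℚ ℚ.* (p ℚ.* B₁) ℚ.+ toℚ d ℚ.* (p ℚ.* B₂)
    -- Multiplying by `d * (1 / d)` gives the first summand the missing factor `d`, so that `d * p`,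
    -- that is `d ^ suc k`, comes out of both.
    ≡⟨ cong (λ e → e ℚ.* (p ℚ.* B₁) ℚ.+ toℚ d ℚ.* (p ℚ.* B₂)) (toℚ-inverse d) ⟨
  toℚ d ℚ.* q ℚ.* (p ℚ.* B₁) ℚ.+ toℚ d ℚ.* (p ℚ.* B₂)
    ≡⟨ solve 5 (λ d q p x y → d :* q :* (p :* x) :+ d :* (p :* y) := d :* p :* (q :* x :+ y)) refl
         (toℚ d) q p B₁ B₂ ⟩
  toℚ d ℚ.* p ℚ.* (q ℚ.* B₁ ℚ.+ B₂)
    ≡⟨ cong₂ ℚ._*_ (sym (toℚ-* d (d ^ k))) (sym (binomialSum-suc d k h)) ⟩
  toℚ (d ^ suc k) ℚ.* binomialSum d (suc k) h ∎
  where
  d = suc n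
  q = + 1 / d
  p = toℚ (d ^ k)
  B₁ = binomialSum d k (h ∘ suc)
  B₂ = binomialSum d k (h ∘ inject₁)

∑zeros≡F : ∀ n (X : Vec ℚ (suc k)) → ∑zeros (suc n) k (lookup X) ≡ toℚ (suc n ^ k) ℚ.* F (2+ n) X
∑zeros≡F {k} n X = ≡.trans (∑zeros≡binomialSum n k (lookup X))
  (cong (toℚ (suc n ^ k) ℚ.*_) (sym (F≡binomialSum n X)))

-- The recurrence in `n` and its initial values

-- A bit and its complement are interpolation coefficients. Making the dependence on `c` linear lets
-- both values of `f` leave the sum over last values.
select : ∀ (c : Vec Bool n) i (f : ℕ → ℚ) →
  f (bit (lookup c i)) ≡ lookup ⟦ c ⟧ i ℚ.* f 1 ℚ.+ lookup ⟦ c ⟧′ i ℚ.* f 0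
select (true  ∷ c) zero    f = solve 2 (λ x y → x := con 1ℚ :* x :+ con 0ℚ :* y) refl (f 1) (f 0)
select (false ∷ c) zero    f = solve 2 (λ x y → y := con 0ℚ :* x :+ con 1ℚ :* y) refl (f 1) (f 0)
select (_     ∷ c) (suc i) f = select c i f

-- The last position uses up one unit of weight when it is in the optimization set and none
-- otherwise. Summing over the last values gives the two factors.
Oℚ-recurrence : ∀ (c : Vec Bool (suc k)) n w → Oℚ c (2+ n) w ≡
  toℚ (suc n ^ k) ℚ.* (F (2+ n) ⟦ c ⟧ ℚ.* Oℚ c (suc n) (w ℤ.- + 1) ℚ.+ F (2+ n) ⟦ c ⟧′ ℚ.* Oℚ c (suc n) w)
Oℚ-recurrence {k} c n w = begin
  Oℚ c (2+ n) w
    ≡⟨ Oℚ-suc c (suc n) w ⟩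
  (∑[ vs ∈ˡ vss ] Oℚ c (suc n) (w ℤ.- + bit (lookup c (zeros vs))))
    ≡⟨ ∑-cong vss (λ vs → select c (zeros vs) (λ b → Oℚ c (suc n) (w ℤ.- + b))) ⟩
  (∑[ vs ∈ˡ vss ] (lookup ⟦ c ⟧ (zeros vs) ℚ.* x ℚ.+ lookup ⟦ c ⟧′ (zeros vs) ℚ.* y))
    ≡⟨ ∑-+ vss _ _ ⟩
  (∑[ vs ∈ˡ vss ] (lookup ⟦ c ⟧ (zeros vs) ℚ.* x))
      ℚ.+ (∑[ vs ∈ˡ vss ] (lookup ⟦ c ⟧′ (zeros vs) ℚ.* y))
    ≡⟨ cong₂ ℚ._+_ (∑-*ʳ vss _ x) (∑-*ʳ vss _ y) ⟩
  ∑zeros (suc n) k (lookup ⟦ c ⟧) ℚ.* x ℚ.+ ∑zeros (suc n) k (lookup ⟦ c ⟧′) ℚ.* y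
    ≡⟨ cong₂ (λ a b → a ℚ.* x ℚ.+ b ℚ.* y) (∑zeros≡F n ⟦ c ⟧) (∑zeros≡F n ⟦ c ⟧′) ⟩
  p ℚ.* F₁ ℚ.* x ℚ.+ p ℚ.* F₂ ℚ.* y
    ≡⟨ solve 5 (λ p a b x y → p :* a :* x :+ p :* b :* y := p :* (a :* x :+ b :* y)) refl
         p F₁ F₂ x y ⟩
  p ℚ.* (F₁ ℚ.* x ℚ.+ F₂ ℚ.* y)
    -- The bit 0 was subtracted as well, and `w - 0` does not reduce to `w`.
    ≡⟨ cong (λ v → p ℚ.* (F₁ ℚ.* x ℚ.+ F₂ ℚ.* Oℚ c (suc n) v)) (ℤ.+-identityʳ w) ⟩
  p ℚ.* (F₁ ℚ.* x ℚ.+ F₂ ℚ.* Oℚ c (suc n) w) ∎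
  where
  vss = words (allFin (2+ n)) k
  p   = toℚ (suc n ^ k)
  F₁  = F (2+ n) ⟦ c ⟧
  F₂  = F (2+ n) ⟦ c ⟧′
  x   = Oℚ c (suc n) (w ℤ.- + 1)
  y   = Oℚ c (suc n) (w ℤ.- + 0)

lookup-fromℕ : ∀ (xs : Vec A (suc n)) → lookup xs (fromℕ n) ≡ last xs
lookup-fromℕ {n = zero}  (x ∷ []) = refl
lookup-fromℕ {n = suc n} (x ∷ xs) = lookup-fromℕ xs

-- There is one empty permutation, hence one tuple, and its weight is 0.
Oℚ-0 : ∀ (c : Vec Bool (suc k)) w → Oℚ c 0 w ≡ ind (does (+ 0 ℤ.≟ w))
Oℚ-0 {k} c w = ∑-words-[] k
  where
  q = ind (does (+ 0 ℤ.≟ w))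
  ∑-words-[] : ∀ k → (∑[ πs ∈ˡ words (permutations 0) k ] q) ≡ q
  ∑-words-[] zero    = ℚ.+-identityʳ q
  ∑-words-[] (suc k) = ≡.trans (∑-words-suc (permutations 0) k (λ _ → q))
    (≡.trans (ℚ.+-identityʳ _) (∑-words-[] k))

-- `F` starts at `j = 2`, so the recurrence does not produce `n = 1`. This case comes from the empty
-- one through `∑zeros-0`.
Oℚ-1 : ∀ (c : Vec Bool (suc k)) w → Oℚ c 1 w ≡ ind (does (+ 0 ℤ.≟ w ℤ.- + bit (last c)))
Oℚ-1 {k} c w = begin
  Oℚ c 1 w
    ≡⟨ Oℚ-suc c 0 w ⟩
  ∑zeros 0 k (λ i → Oℚ c 0 (w ℤ.- + bit (lookup c i)))
    ≡⟨ ∑zeros-0 k (λ i → Oℚ c 0 (w ℤ.- + bit (lookup c i))) ⟩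
  Oℚ c 0 (w ℤ.- + bit (lookup c (fromℕ k)))
    ≡⟨ cong (λ b → Oℚ c 0 (w ℤ.- + bit b)) (lookup-fromℕ c) ⟩
  Oℚ c 0 (w ℤ.- + bit (last c))
    ≡⟨ Oℚ-0 c (w ℤ.- + bit (last c)) ⟩
  ind (does (+ 0 ℤ.≟ w ℤ.- + bit (last c))) ∎

-- Solving the recurrence

-- The coefficient of t^s in ∏_{i<n} (g i + f i t).  Taking s in ℤ spares the
-- recursion a special case at s = 0.
subsetSum : (f g : ℕ → ℚ) → ℕ → ℤ → ℚ
subsetSum f g zero    s = ind (does (+ 0 ℤ.≟ s))
subsetSum f g (suc n) s =
  f 0 ℚ.* subsetSum (f ∘ suc) (g ∘ suc) n (s ℤ.- + 1) ℚ.+ g 0 ℚ.* subsetSum (f ∘ suc) (g ∘ suc) n s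

-- `subsetSum` peels off the factor of index 0, whereas the recurrence in `n` supplies the factor of
-- highest index. The factors commute, so either end may be peeled.
subsetSum-last : ∀ f g n s → subsetSum f g (suc n) s
  ≡ f n ℚ.* subsetSum f g n (s ℤ.- + 1) ℚ.+ g n ℚ.* subsetSum f g n s
subsetSum-last f g zero    s = refl
subsetSum-last f g (suc n) s = ≡.trans
  (cong₂ (λ a b → f 0 ℚ.* a ℚ.+ g 0 ℚ.* b)
    (subsetSum-last (f ∘ suc) (g ∘ suc) n (s ℤ.- + 1)) (subsetSum-last (f ∘ suc) (g ∘ suc) n s))
  -- `x`, `y`, `z` are the remaining sums at `s - 2`, `s - 1` and `s`; the two mixed terms share
  -- `y`.
  (solve 7 (λ f0 g0 fn gn x y z → f0 :* (fn :* x :+ gn :* y) :+ g0 :* (fn :* y :+ gn :* z)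
      := fn :* (f0 :* x :+ g0 :* y) :+ gn :* (f0 :* y :+ g0 :* z)) refl
    (f 0) (g 0) (f (suc n)) (g (suc n)) _ _ _)

^-*-distrib : ∀ a b k → (a * b) ^ k ≡ a ^ k * b ^ k
^-*-distrib a b zero    = refl
^-*-distrib a b (suc k) = ≡.trans (cong (a * b *_) (^-*-distrib a b k))
  (ℕ.[m*n]*[o*p]≡[m*o]*[n*p] a b (a ^ k) (b ^ k))

-- `Oℚ-recurrence` and `subsetSum-last` have the same shape. The powers `suc n ^ k` accumulate to a
-- power of the factorial, and the bit of position 1 stays as a shift of the weight.
Oℚ≡subsetSum : ∀ (c : Vec Bool (suc k)) n w → Oℚ c (suc n) w ≡ toℚ ((n !) ^ k) ℚ.*
  subsetSum (λ i → F (2+ i) ⟦ c ⟧) (λ i → F (2+ i) ⟦ c ⟧′) n (w ℤ.- + bit (last c))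
Oℚ≡subsetSum {k} c zero    w = begin
  Oℚ c 1 w                ≡⟨ Oℚ-1 c w ⟩
  δ                       ≡⟨ ℚ.*-identityˡ δ ⟨
  1ℚ ℚ.* δ                ≡⟨ cong (λ m → toℚ m ℚ.* δ) (ℕ.^-zeroˡ k) ⟨
  toℚ (1 ^ k) ℚ.* δ       ∎
  where δ = ind (does (+ 0 ℤ.≟ w ℤ.- + bit (last c)))
Oℚ≡subsetSum {k} c (suc n) w = begin
  Oℚ c (2+ n) w
    ≡⟨ Oℚ-recurrence c n w ⟩
  p ℚ.* (f n ℚ.* Oℚ c (suc n) (w ℤ.- + 1) ℚ.+ g n ℚ.* Oℚ c (suc n) w)
    ≡⟨ cong₂ (λ x y → p ℚ.* (f n ℚ.* x ℚ.+ g n ℚ.* y)) (Oℚ≡subsetSum c n (w ℤ.- + 1)) (Oℚ≡subsetSum c n w) ⟩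
  p ℚ.* (f n ℚ.* (r ℚ.* subsetSum f g n (w ℤ.- + 1 ℤ.- b)) ℚ.+ g n ℚ.* (r ℚ.* y))
    -- The induction hypothesis subtracts 1 before the bit, `subsetSum-last` after it.
    ≡⟨ cong (λ v → p ℚ.* (f n ℚ.* (r ℚ.* subsetSum f g n v) ℚ.+ g n ℚ.* (r ℚ.* y))) -‿swap ⟩
  p ℚ.* (f n ℚ.* (r ℚ.* x) ℚ.+ g n ℚ.* (r ℚ.* y))
    ≡⟨ solve 6 (λ p r a b x y → p :* (a :* (r :* x) :+ b :* (r :* y)) := p :* r :* (a :* x :+ b :* y)) refl
         p r (f n) (g n) x y ⟩
  p ℚ.* r ℚ.* (f n ℚ.* x ℚ.+ g n ℚ.* y)
    ≡⟨ cong₂ ℚ._*_ (toℚ-* (suc n ^ k) ((n !) ^ k)) (subsetSum-last f g n (w ℤ.- b)) ⟨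
  toℚ (suc n ^ k * (n !) ^ k) ℚ.* subsetSum f g (suc n) (w ℤ.- b)
    ≡⟨ cong (λ m → toℚ m ℚ.* subsetSum f g (suc n) (w ℤ.- b)) (^-*-distrib (suc n) (n !) k) ⟨
  toℚ ((suc n !) ^ k) ℚ.* subsetSum f g (suc n) (w ℤ.- b) ∎
  where
  f = λ i → F (2+ i) ⟦ c ⟧
  g = λ i → F (2+ i) ⟦ c ⟧′
  p = toℚ (suc n ^ k)
  r = toℚ ((n !) ^ k)
  b = + bit (last c)
  x = subsetSum f g n (w ℤ.- b ℤ.- + 1)
  y = subsetSum f g n (w ℤ.- b)
  -‿swap : w ℤ.- + 1 ℤ.- b ≡ w ℤ.- b ℤ.- + 1
  -‿swap = ℤ-Solver.solve 3 (λ w a b → w ℤ-Solver.:- a ℤ-Solver.:- b ℤ-Solver.:= w ℤ-Solver.:- b ℤ-Solver.:- a)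
    refl w (+ 1) b

-- Expansion over subsets

-- ∏-from2 evaluates its argument at j ≥ 2 only, so j ∸ 2 does not truncate.
∏ : Subset n → (ℕ → ℚ) → ℚ
∏ J p = ∏-from2 J (λ j → p (j ∸ 2))

filter-∈?-suc : ∀ b (J : Subset n) xs →
  filter (_∈? (b ∷ J)) (List.map suc xs) ≡ List.map suc (filter (_∈? J) xs)
filter-∈?-suc b J []       = refl
filter-∈?-suc b J (x ∷ xs) with does (x ∈? J)
... | true  = cong (suc x ∷_) (filter-∈?-suc b J xs)
... | false = filter-∈?-suc b J xs

-- The left side is what `∏ (b ∷ J) p` leaves for the indices above 0 once the membership of index 0
-- has been computed.
∏-suc : ∀ b (J : Subset n) p →
  List.foldr ℚ._*_ 1ℚ (List.map (p ∘ toℕ) (filter (_∈? (b ∷ J)) (List.tabulate suc)))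
    ≡ ∏ J (p ∘ suc)
∏-suc b J p = cong (List.foldr ℚ._*_ 1ℚ) (begin
  List.map (p ∘ toℕ) (filter (_∈? (b ∷ J)) (List.tabulate suc))
    ≡⟨ cong (List.map (p ∘ toℕ) ∘ filter (_∈? (b ∷ J))) (List.map-tabulate id suc) ⟨
  List.map (p ∘ toℕ) (filter (_∈? (b ∷ J)) (List.map suc (allFin _)))
    ≡⟨ cong (List.map (p ∘ toℕ)) (filter-∈?-suc b J (allFin _)) ⟩
  List.map (p ∘ toℕ) (List.map suc (filter (_∈? J) (allFin _)))
    ≡⟨ List.map-∘ (filter (_∈? J) (allFin _)) ⟨
  List.map (p ∘ suc ∘ toℕ) (filter (_∈? J) (allFin _)) ∎)

∏-true : ∀ (J : Subset n) p → ∏ (true ∷ J) p ≡ p 0 ℚ.* ∏ J (p ∘ suc)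
∏-true J p = cong (p 0 ℚ.*_) (∏-suc true J p)

∏-false : ∀ (J : Subset n) p → ∏ (false ∷ J) p ≡ ∏ J (p ∘ suc)
∏-false J p = ∏-suc false J p

-- The first bit of `J` decides whether index 0 contributes `f 0` and one element or `g 0` and none,
-- which is the recursion of `subsetSum`.
subsetSum-words : ∀ f g n s →
  (∑[ J ∈ˡ words (false ∷ true ∷ []) n ] (ind (does (+ ∣ J ∣ ℤ.≟ s)) ℚ.* (∏ J f ℚ.* ∏ (∁ J) g)))
    ≡ subsetSum f g n s
subsetSum-words f g zero    s =
  solve 1 (λ x → x :* (con 1ℚ :* con 1ℚ) :+ con 0ℚ := x) refl (ind (does (+ 0 ℤ.≟ s)))
subsetSum-words f g (suc n) s = begin
  ∑-list (words bs (suc n)) t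
    ≡⟨ ∑-words-suc bs n t ⟩
  -- The alphabet lists `false` first, so the part with `g 0` precedes until the final swap.
  ∑-list (words bs n) (t ∘ (false ∷_)) ℚ.+ (∑-list (words bs n) (t ∘ (true ∷_)) ℚ.+ 0ℚ)
    ≡⟨ cong₂ (λ x y → x ℚ.+ (y ℚ.+ 0ℚ)) (∑-cong (words bs n) outside) (∑-cong (words bs n) inside) ⟩
  (∑[ J ∈ˡ words bs n ] (g 0 ℚ.* u s J)) ℚ.+ ((∑[ J ∈ˡ words bs n ] (f 0 ℚ.* u (s ℤ.- + 1) J)) ℚ.+ 0ℚ)
    ≡⟨ cong₂ (λ x y → x ℚ.+ (y ℚ.+ 0ℚ))
         (∑-*ˡ (g 0) (words bs n) (u s)) (∑-*ˡ (f 0) (words bs n) (u (s ℤ.- + 1))) ⟩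
  g 0 ℚ.* ∑-list (words bs n) (u s) ℚ.+ (f 0 ℚ.* ∑-list (words bs n) (u (s ℤ.- + 1)) ℚ.+ 0ℚ)
    ≡⟨ cong₂ (λ x y → g 0 ℚ.* x ℚ.+ (f 0 ℚ.* y ℚ.+ 0ℚ))
         (subsetSum-words (f ∘ suc) (g ∘ suc) n s) (subsetSum-words (f ∘ suc) (g ∘ suc) n (s ℤ.- + 1)) ⟩
  g 0 ℚ.* e₀ ℚ.+ (f 0 ℚ.* e₁ ℚ.+ 0ℚ)
    ≡⟨ solve 2 (λ x y → x :+ (y :+ con 0ℚ) := y :+ x) refl (g 0 ℚ.* e₀) (f 0 ℚ.* e₁) ⟩
  subsetSum f g (suc n) s ∎
  where
  bs = false ∷ true ∷ []
  e₀ = subsetSum (f ∘ suc) (g ∘ suc) n s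
  e₁ = subsetSum (f ∘ suc) (g ∘ suc) n (s ℤ.- + 1)
  t : Subset (suc n) → ℚ
  t J = ind (does (+ ∣ J ∣ ℤ.≟ s)) ℚ.* (∏ J f ℚ.* ∏ (∁ J) g)
  u : ℤ → Subset n → ℚ
  u s J = ind (does (+ ∣ J ∣ ℤ.≟ s)) ℚ.* (∏ J (f ∘ suc) ℚ.* ∏ (∁ J) (g ∘ suc))
  outside : ∀ J → t (false ∷ J) ≡ g 0 ℚ.* u s J
  outside J = ≡.trans
    (cong₂ (λ a b → ind (does (+ ∣ J ∣ ℤ.≟ s)) ℚ.* (a ℚ.* b)) (∏-false J f) (∏-true (∁ J) g))
    (solve 4 (λ i a g b → i :* (a :* (g :* b)) := g :* (i :* (a :* b))) refl
      (ind (does (+ ∣ J ∣ ℤ.≟ s))) (∏ J (f ∘ suc)) (g 0) (∏ (∁ J) (g ∘ suc)))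
  inside : ∀ J → t (true ∷ J) ≡ f 0 ℚ.* u (s ℤ.- + 1) J
  inside J = ≡.trans
    (cong₂ ℚ._*_ (cong ind (does-+-≟ ∣ J ∣ 1 s)) (cong₂ ℚ._*_ (∏-true J f) (∏-false (∁ J) g)))
    (solve 4 (λ i f a b → i :* (f :* a :* b) := f :* (i :* (a :* b))) refl
      (ind (does (+ ∣ J ∣ ℤ.≟ s ℤ.- + 1))) (f 0) (∏ J (f ∘ suc)) (∏ (∁ J) (g ∘ suc)))

-- Sizes are tested in `ℕ` on the left and in `ℤ` on the right; the tests agree because `+_` is
-- injective.
subsetSum-subsetsOfSize : ∀ f g n s →
  (∑[ J ∈ˡ subsetsOfSize s n ] (∏ J f ℚ.* ∏ (∁ J) g)) ≡ subsetSum f g n (+ s)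
subsetSum-subsetsOfSize f g n s = begin
  ∑-list (subsetsOfSize s n) t
    ≡⟨ ∑-filter (λ J → ∣ J ∣ ℕ.≟ s) (words (false ∷ true ∷ []) n) t ⟩
  (∑[ J ∈ˡ words (false ∷ true ∷ []) n ] (if does (∣ J ∣ ℕ.≟ s) then t J else 0ℚ))
    ≡⟨ ∑-cong (words (false ∷ true ∷ []) n) (λ J → ≡.trans (if-ind _ (t J))
         (cong (λ b → ind b ℚ.* t J) (does-⇔ (mk⇔ (cong (λ j → + j)) ℤ.+-injective)
           (∣ J ∣ ℕ.≟ s) (+ ∣ J ∣ ℤ.≟ + s)))) ⟩
  (∑[ J ∈ˡ words (false ∷ true ∷ []) n ] (ind (does (+ ∣ J ∣ ℤ.≟ + s)) ℚ.* t J))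
    ≡⟨ subsetSum-words f g n (+ s) ⟩
  subsetSum f g n (+ s) ∎
  where
  t : Subset n → ℚ
  t J = ∏ J f ℚ.* ∏ (∁ J) g

-- In the sum over subsets every indicator is zero, since a subset of `Fin n` has at most `n`
-- elements.
subsetSum-vanishes : ∀ f g n s → (∀ j → j ≤ n → + j ≢ s) → subsetSum f g n s ≡ 0ℚ
subsetSum-vanishes f g n s out = begin
  subsetSum f g n s
    ≡⟨ subsetSum-words f g n s ⟨
  (∑[ J ∈ˡ words bs n ] (ind (does (+ ∣ J ∣ ℤ.≟ s)) ℚ.* t J))
    ≡⟨ ∑-cong (words bs n) (λ J → cong (λ b → ind b ℚ.* t J)
         (dec-false (+ ∣ J ∣ ℤ.≟ s) (out ∣ J ∣ (∣p∣≤n J)))) ⟩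
  (∑[ J ∈ˡ words bs n ] (0ℚ ℚ.* t J))
    ≡⟨ ∑-*ˡ 0ℚ (words bs n) t ⟩
  0ℚ ℚ.* ∑-list (words bs n) t
    ≡⟨ ℚ.*-zeroˡ (∑-list (words bs n) t) ⟩
  0ℚ ∎
  where
  bs = false ∷ true ∷ []
  t : Subset n → ℚ
  t J = ∏ J f ℚ.* ∏ (∁ J) g

theorem2p1 : (k n : ℕ) .{{_ : NonZero k}} .{{_ : NonZero n}} (c : Vec Bool (suc k)) →
    ((m : ℕ) → 1 ≤ m → m ≤ n →
    toℚ (O c n (+ m ℤ.+ + bit (last c) ℤ.- + 1))
    ≡ toℚ ((pred n !) ^ k) ℚ.*
    (∑[ J ∈ˡ subsetsOfSize (m ∸ 1) (pred n) ]
    ((∏[ j ∈ J ] F j ⟦ c ⟧) ℚ.* (∏[ j ∈ ∁ J ] F j ⟦ c ⟧′))))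
    × ((m : ℕ) → m ≡ 0 ⊎ m > n →
    O c n (+ m ℤ.+ + bit (last c) ℤ.- + 1) ≡ 0)
theorem2p1 k (suc n) c = value , vanishing
  where
  f = λ i → F (2+ i) ⟦ c ⟧
  g = λ i → F (2+ i) ⟦ c ⟧′
  b = + bit (last c)
  r = toℚ ((n !) ^ k)
  -- The bit added to the weight cancels the contribution of position 1, which leaves the size
  -- `m - 1`.
  O≡subsetSum : ∀ m → toℚ (O c (suc n) (+ m ℤ.+ b ℤ.- + 1)) ≡ r ℚ.* subsetSum f g n (+ m ℤ.- + 1)
  O≡subsetSum m = begin
    toℚ (O c (suc n) w)                ≡⟨ toℚ-O c (suc n) w ⟩
    Oℚ c (suc n) w                     ≡⟨ Oℚ≡subsetSum c n w ⟩
    r ℚ.* subsetSum f g n (w ℤ.- b)    ≡⟨ cong (λ s → r ℚ.* subsetSum f g n s) b-cancels ⟩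
    r ℚ.* subsetSum f g n (+ m ℤ.- + 1) ∎
    where
    w = + m ℤ.+ b ℤ.- + 1
    b-cancels : w ℤ.- b ≡ + m ℤ.- + 1
    b-cancels = ℤ-Solver.solve 3
      (λ m b a → ((m ℤ-Solver.:+ b) ℤ-Solver.:- a) ℤ-Solver.:- b ℤ-Solver.:= m ℤ-Solver.:- a)
      refl (+ m) b (+ 1)
  value : ∀ m → 1 ≤ m → m ≤ suc n → _
  -- Both `+ suc m - + 1` and `suc m ∸ 1` compute, to `+ m` and `m`.
  value (suc m) _ _ = ≡.trans (O≡subsetSum (suc m))
    (cong (r ℚ.*_) (sym (subsetSum-subsetsOfSize f g n m)))
  out : ∀ m → m ≡ 0 ⊎ m > suc n → ∀ j → j ≤ n → + j ≢ + m ℤ.- + 1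
  -- The size is -1 here, which is no `+ j`.
  out zero    _                j j≤n ()
  -- The size is `m` here, and `n < m` puts it above every `j ≤ n`.
  out (suc m) (inj₂ (s≤s n<m)) j j≤n eq = ℕ.<⇒≢ (ℕ.≤-<-trans j≤n n<m) (ℤ.+-injective eq)
  vanishing : ∀ m → m ≡ 0 ⊎ m > suc n → _
  -- `0ℚ` is `toℚ 0`, so the computation in `ℚ` can be pulled back to `ℕ`.
  vanishing m h = toℚ-injective (begin
    toℚ (O c (suc n) (+ m ℤ.+ b ℤ.- + 1)) ≡⟨ O≡subsetSum m ⟩
    r ℚ.* subsetSum f g n (+ m ℤ.- + 1)   ≡⟨ cong (r ℚ.*_) (subsetSum-vanishes f g n _ (out m h)) ⟩
    r ℚ.* 0ℚ                              ≡⟨ ℚ.*-zeroʳ r ⟩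
    0ℚ                                    ∎)
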